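{- For every $n\in\mathbb N$ and every $a\in USC([0,1]_u^n)$: if for every topological space $X$ and every $f\in USC(X)^n$ one has $a\cdot f=\underline 0$, then for every locale $\mathcal L$ and every $f\in USC(\mathcal L)^n$ one has $a\cdot f=\underline 0$.
   Context: $[0,1]_u$ is $[0,1]$ with the topology whose open sets are $[0,q)$, $q\in[0,1]$, and $[0,1]$. For a topological space $X$, $USC(X)$ is the set of upper semi-continuous functions $X\to[0,1]$ (equivalently, continuous maps $X\to[0,1]_u$). $USC([0,1]_u^n)$ is the case $X=[0,1]_u^n$ (product topology). For $f=(f_1,\dots,f_n)\in USC(X)^n$, $a\cdot f=a\circ f$, and $\underline 0$ is the constant function $0$. For a locale $\mathcal L$ (least $\bot$, greatest $\top$), $USC(\mathcal L)$ is the set of maps $f:[0,1]\to\mathcal L$ preserving arbitrary suprema (so $f(0)=\bot$), ordered by $f\le g\iff g(q)\le f(q)$ for all $q$; its least element is $\underline 0$, with $\underline 0(q)=\top$ for $q>0$ and $\underline 0(0)=\bot$. For $f\in USC(\mathcal L)$ let $G(f)$ map the open set $[0,q)$ of $[0,1]_u$ to $f(q)$ and the open set $[0,1]$ to $\top$. For $f\in USC(\mathcal L)^n$, $a\cdot f\in USC(\mathcal L)$ is defined by $(a\cdot f)(q)=\bigvee\{G(f_1)(U_1)\wedge\dots\wedge G(f_n)(U_n): U_i\text{ open in }[0,1]_u,\ U_1\times\dots\times U_n\subset a^{ -1}([0,q))\}$. -}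

module Defs where

open import Data.Empty using (⊥; ⊥-elim)
open import Data.Fin.Base using (Fin; zero; suc)
open import Data.Nat.Base as ℕ using (ℕ; zero; suc)
import Data.Nat.Properties as ℕ
open import Data.Product using (Σ; ∃; _×_; _,_; proj₁; proj₂)
open import Data.Rational as ℚ using (ℚ; 0ℚ; 1ℚ; ½)
import Data.Rational.Properties as ℚ
open import Data.Sum.Base using (inj₁; inj₂)
open import Data.Unit.Base using (⊤; tt)
open import Data.Bool.Base using (Bool; true; false)
open import Data.Vec.Functional using (Vector; foldr)
import Data.Vec.Functional.Relation.Binary.Equality.Setoid as Pointwise
open import Function.Base using (_∘_)
open import Level using (Level; 0ℓ; _⊔_; Lift; lift; lower) renaming (suc to lsuc)
open import Relation.Binary.Bundles using (Setoid)
open import Relation.Binary.Definitions using (_Respects_)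
open import Relation.Binary.Lattice.Bundles using (BoundedMeetSemilattice)
open import Relation.Binary.PropositionalEquality.Core
  using (_≡_; refl; sym; trans; cong; subst)
open import Relation.Nullary.Negation.Core using (¬_)
open import Relation.Unary using (Pred; _∈_; _⊆_; _≐_; _∩_; ⋃)

private variable
  c ℓ ℓ₁ ℓ₂ p o ι : Level
  n : ℕ

Eventually : Pred (Pred ℕ ℓ) ℓ
Eventually P = ∃ λ N → ∀ n → N ℕ.≤ n → P n

Eventually-map : {P : Pred ℕ ℓ₁} {Q : Pred ℕ ℓ₂} →
                 (∀ n → P n → Q n) → Eventually P → Eventually Q
Eventually-map f (N , P) = N , λ n N≤n → f n (P n N≤n)

Eventually-zip : {P : Pred ℕ ℓ₁} {Q : Pred ℕ ℓ₂} {R : Pred ℕ ℓ} →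
                 (∀ n → P n → Q n → R n) →
                 Eventually P → Eventually Q → Eventually R
Eventually-zip f (M , P) (N , Q) = M ℕ.⊔ N , λ n M⊔N≤n →
  f n (P n (ℕ.≤-trans (ℕ.m≤m⊔n M N) M⊔N≤n))
      (Q n (ℕ.≤-trans (ℕ.m≤n⊔m M N) M⊔N≤n))

record ℝ : Set where
  field
    seq    : ℕ → ℚ
    -- Quantifying over both orders of m and n makes this |seq m - seq n| ≤ ε.
    cauchy : ∀ ε → 0ℚ ℚ.< ε → ∃ λ N → ∀ m n → N ℕ.≤ m → N ℕ.≤ n →
             seq m ℚ.≤ seq n ℚ.+ ε
open ℝ public

infix 4 _<ᴿ_ _≤ᴿ_

_<ᴿ_ : ℝ → ℝ → Set
x <ᴿ y = ∃ λ ε → 0ℚ ℚ.< ε × Eventually λ n → seq x n ℚ.+ ε ℚ.≤ seq y n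

_≤ᴿ_ : ℝ → ℝ → Set
x ≤ᴿ y = ∀ ε → 0ℚ ℚ.< ε → Eventually λ n → seq x n ℚ.≤ seq y n ℚ.+ ε

p≤p+ε : ∀ p {ε} → 0ℚ ℚ.< ε → p ℚ.≤ p ℚ.+ ε
p≤p+ε p 0<ε = ℚ.≤-trans (ℚ.≤-reflexive (sym (ℚ.+-identityʳ p)))
                        (ℚ.+-monoʳ-≤ p (ℚ.<⇒≤ 0<ε))

+-cancelʳ-≤ : ∀ r {p q} → p ℚ.+ r ℚ.≤ q ℚ.+ r → p ℚ.≤ q
+-cancelʳ-≤ r {p} {q} h =
  subst (ℚ._≤ q) (simp p) (subst (_ ℚ.≤_) (simp q) (ℚ.+-monoˡ-≤ (ℚ.- r) h))
  where
  simp : ∀ s → (s ℚ.+ r) ℚ.+ ℚ.- r ≡ s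
  simp s = trans (ℚ.+-assoc s r (ℚ.- r))
                 (trans (cong (s ℚ.+_) (ℚ.+-inverseʳ r)) (ℚ.+-identityʳ s))

halve : ∀ {ε} → 0ℚ ℚ.< ε → ∃ λ δ → 0ℚ ℚ.< δ × δ ℚ.+ δ ≡ ε
halve {ε} 0<ε = ½ ℚ.* ε , ℚ.*-monoʳ-<-pos ½ 0<ε ,
  trans (sym (ℚ.*-distribʳ-+ ε ½ ½)) (ℚ.*-identityˡ ε)

regroup : ∀ p {δ ε} → δ ℚ.+ δ ≡ ε → (p ℚ.+ δ) ℚ.+ δ ≡ p ℚ.+ ε
regroup p {δ} eq = trans (ℚ.+-assoc p δ δ) (cong (p ℚ.+_) eq)

≤ᴿ-refl : ∀ x → x ≤ᴿ x
≤ᴿ-refl x ε 0<ε = 0 , λ n _ → p≤p+ε (seq x n) 0<ε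

≤ᴿ-trans : ∀ x y z → x ≤ᴿ y → y ≤ᴿ z → x ≤ᴿ z
≤ᴿ-trans x y z x≤y y≤z ε 0<ε with halve 0<ε
... | δ , 0<δ , eq = Eventually-zip
  (λ n a b → subst (seq x n ℚ.≤_) (regroup (seq z n) eq)
               (ℚ.≤-trans a (ℚ.+-monoˡ-≤ δ b)))
  (x≤y δ 0<δ) (y≤z δ 0<δ)

<ᴿ⇒≤ᴿ : ∀ x y → x <ᴿ y → x ≤ᴿ y
<ᴿ⇒≤ᴿ x y (δ , 0<δ , x<y) ε 0<ε = Eventually-map
  (λ n a → ℚ.≤-trans (p≤p+ε (seq x n) 0<δ) (ℚ.≤-trans a (p≤p+ε (seq y n) 0<ε)))
  x<y

<ᴿ-≤ᴿ-trans : ∀ x y z → x <ᴿ y → y ≤ᴿ z → x <ᴿ z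
<ᴿ-≤ᴿ-trans x y z (ε , 0<ε , x<y) y≤z with halve 0<ε
... | δ , 0<δ , eq = δ , 0<δ , Eventually-zip
  (λ n a b → +-cancelʳ-≤ δ
    (ℚ.≤-trans (ℚ.≤-reflexive (regroup (seq x n) eq)) (ℚ.≤-trans a b)))
  x<y (y≤z δ 0<δ)

≤ᴿ-<ᴿ-trans : ∀ x y z → x ≤ᴿ y → y <ᴿ z → x <ᴿ z
≤ᴿ-<ᴿ-trans x y z x≤y (ε , 0<ε , y<z) with halve 0<ε
... | δ , 0<δ , eq = δ , 0<δ , Eventually-zip
  (λ n a b → ℚ.≤-trans (ℚ.+-monoˡ-≤ δ a)
    (ℚ.≤-trans (ℚ.≤-reflexive (regroup (seq y n) eq)) b))
  (x≤y δ 0<δ) y<z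

<ᴿ-irrefl : ∀ x → ¬ (x <ᴿ x)
<ᴿ-irrefl x (ε , 0<ε , N , x<x) = ℚ.<-irrefl refl
  (ℚ.<-≤-trans (ℚ.≤-<-trans (ℚ.≤-reflexive (sym (ℚ.+-identityʳ (seq x N))))
                            (ℚ.+-monoʳ-< (seq x N) 0<ε))
               (x<x N ℕ.≤-refl))

fromℚ : ℚ → ℝ
fromℚ q = record { seq = λ _ → q ; cauchy = λ _ 0<ε → 0 , λ _ _ _ _ → p≤p+ε q 0<ε }

0ᴿ 1ᴿ : ℝ
0ᴿ = fromℚ 0ℚ
1ᴿ = fromℚ 1ℚ

0ᴿ<1ᴿ : 0ᴿ <ᴿ 1ᴿ
0ᴿ<1ᴿ = 1ℚ , ℚ.positive⁻¹ 1ℚ , 0 , λ _ _ → ℚ.≤-reflexive (ℚ.+-identityˡ 1ℚ)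

_+ʳ_ : ℝ → ℚ → ℝ
seq    (x +ʳ δ) n = seq x n ℚ.+ δ
cauchy (x +ʳ δ) ε 0<ε with cauchy x ε 0<ε
... | N , h = N , λ m n N≤m N≤n → ℚ.≤-trans (ℚ.+-monoˡ-≤ δ (h m n N≤m N≤n))
  (ℚ.≤-reflexive (trans (ℚ.+-assoc (seq x n) ε δ)
    (trans (cong (seq x n ℚ.+_) (ℚ.+-comm ε δ)) (sym (ℚ.+-assoc (seq x n) δ ε)))))

<ᴿ-dense : ∀ x y → x <ᴿ y → ∃ λ z → x <ᴿ z × z <ᴿ y
<ᴿ-dense x y (ε , 0<ε , x<y) with halve 0<ε
... | δ , 0<δ , eq = x +ʳ δ
  , (δ , 0<δ , 0 , λ _ _ → ℚ.≤-refl)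
  , (δ , 0<δ , Eventually-map
      (λ n → ℚ.≤-trans (ℚ.≤-reflexive (regroup (seq x n) eq))) x<y)

⊓-mono-+ : ∀ a b c d ε → a ℚ.≤ b ℚ.+ ε → c ℚ.≤ d ℚ.+ ε → a ℚ.⊓ c ℚ.≤ (b ℚ.⊓ d) ℚ.+ ε
⊓-mono-+ a b c d ε a≤b c≤d with ℚ.⊓-sel b d
... | inj₁ eq = subst (λ r → a ℚ.⊓ c ℚ.≤ r ℚ.+ ε) (sym eq) (ℚ.≤-trans (ℚ.p⊓q≤p a c) a≤b)
... | inj₂ eq = subst (λ r → a ℚ.⊓ c ℚ.≤ r ℚ.+ ε) (sym eq) (ℚ.≤-trans (ℚ.p⊓q≤q a c) c≤d)

_⊓ᴿ_ : ℝ → ℝ → ℝ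
seq    (x ⊓ᴿ y) n = seq x n ℚ.⊓ seq y n
cauchy (x ⊓ᴿ y) ε 0<ε with cauchy x ε 0<ε | cauchy y ε 0<ε
... | M , h | N , k = M ℕ.⊔ N , λ m n m≥ n≥ → ⊓-mono-+ (seq x m) (seq x n) (seq y m) (seq y n) ε
  (h m n (ℕ.≤-trans (ℕ.m≤m⊔n M N) m≥) (ℕ.≤-trans (ℕ.m≤m⊔n M N) n≥))
  (k m n (ℕ.≤-trans (ℕ.m≤n⊔m M N) m≥) (ℕ.≤-trans (ℕ.m≤n⊔m M N) n≥))

⊓ᴿ≤ˡ : ∀ x y → x ⊓ᴿ y ≤ᴿ x
⊓ᴿ≤ˡ x y ε 0<ε = 0 , λ n _ →
  ℚ.≤-trans (ℚ.p⊓q≤p (seq x n) (seq y n)) (p≤p+ε (seq x n) 0<ε)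

⊓ᴿ≤ʳ : ∀ x y → x ⊓ᴿ y ≤ᴿ y
⊓ᴿ≤ʳ x y ε 0<ε = 0 , λ n _ →
  ℚ.≤-trans (ℚ.p⊓q≤q (seq x n) (seq y n)) (p≤p+ε (seq y n) 0<ε)

⊓ᴿ-≤-glb : ∀ x y z → z ≤ᴿ x → z ≤ᴿ y → z ≤ᴿ x ⊓ᴿ y
⊓ᴿ-≤-glb x y z z≤x z≤y ε 0<ε = Eventually-zip
  (λ n a b → ℚ.≤-trans (ℚ.⊓-glb ℚ.≤-refl ℚ.≤-refl)
               (⊓-mono-+ (seq z n) (seq x n) (seq z n) (seq y n) ε a b))
  (z≤x ε 0<ε) (z≤y ε 0<ε)

⊓ᴿ-<-glb : ∀ x y z → z <ᴿ x → z <ᴿ y → z <ᴿ x ⊓ᴿ y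
⊓ᴿ-<-glb x y z (ε , 0<ε , z<x) (δ , 0<δ , z<y) = ε ℚ.⊓ δ , 0<ε⊓δ , Eventually-zip
  (λ n a b → ℚ.⊓-glb
    (ℚ.≤-trans (ℚ.+-monoʳ-≤ (seq z n) (ℚ.p⊓q≤p ε δ)) a)
    (ℚ.≤-trans (ℚ.+-monoʳ-≤ (seq z n) (ℚ.p⊓q≤q ε δ)) b))
  z<x z<y
  where
  0<ε⊓δ : 0ℚ ℚ.< ε ℚ.⊓ δ
  0<ε⊓δ with ℚ.⊓-sel ε δ
  ... | inj₁ eq = subst (0ℚ ℚ.<_) (sym eq) 0<ε
  ... | inj₂ eq = subst (0ℚ ℚ.<_) (sym eq) 0<δ

record 𝕀 : Set where
  field
    value   : ℝ
    0≤value : 0ᴿ ≤ᴿ value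
    value≤1 : value ≤ᴿ 1ᴿ
open 𝕀 public

infix 4 _<_ _≤_

_<_ _≤_ : 𝕀 → 𝕀 → Set
x < y = value x <ᴿ value y
x ≤ y = value x ≤ᴿ value y

0𝕀 1𝕀 : 𝕀
0𝕀 = record { value = 0ᴿ ; 0≤value = ≤ᴿ-refl 0ᴿ ; value≤1 = <ᴿ⇒≤ᴿ 0ᴿ 1ᴿ 0ᴿ<1ᴿ }
1𝕀 = record { value = 1ᴿ ; 0≤value = <ᴿ⇒≤ᴿ 0ᴿ 1ᴿ 0ᴿ<1ᴿ ; value≤1 = ≤ᴿ-refl 1ᴿ }

<-≤-trans : ∀ x y z → x < y → y ≤ z → x < z
<-≤-trans x y z = <ᴿ-≤ᴿ-trans (value x) (value y) (value z)

≤-<-trans : ∀ x y z → x ≤ y → y < z → x < z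
≤-<-trans x y z = ≤ᴿ-<ᴿ-trans (value x) (value y) (value z)

<⇒≤ : ∀ x y → x < y → x ≤ y
<⇒≤ x y = <ᴿ⇒≤ᴿ (value x) (value y)

≤-refl : ∀ x → x ≤ x
≤-refl x = ≤ᴿ-refl (value x)

≤-trans : ∀ x y z → x ≤ y → y ≤ z → x ≤ z
≤-trans x y z = ≤ᴿ-trans (value x) (value y) (value z)

x≮0 : ∀ x → ¬ (x < 0𝕀)
x≮0 x x<0 = <ᴿ-irrefl 0ᴿ (≤ᴿ-<ᴿ-trans 0ᴿ (value x) 0ᴿ (0≤value x) x<0)

1≮x : ∀ x → ¬ (1𝕀 < x)
1≮x x 1<x = <ᴿ-irrefl 1ᴿ (<ᴿ-≤ᴿ-trans 1ᴿ (value x) 1ᴿ 1<x (value≤1 x))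

<-dense : ∀ x y → x < y → ∃ λ z → x < z × z < y
<-dense x y x<y with <ᴿ-dense (value x) (value y) x<y
... | z , x<z , z<y = record
  { value   = z
  ; 0≤value = ≤ᴿ-trans 0ᴿ (value x) z (0≤value x) (<ᴿ⇒≤ᴿ (value x) z x<z)
  ; value≤1 = ≤ᴿ-trans z (value y) 1ᴿ (<ᴿ⇒≤ᴿ z (value y) z<y) (value≤1 y)
  } , x<z , z<y

_⊓_ : 𝕀 → 𝕀 → 𝕀
x ⊓ y = record
  { value   = value x ⊓ᴿ value y
  ; 0≤value = ⊓ᴿ-≤-glb (value x) (value y) 0ᴿ (0≤value x) (0≤value y)
  ; value≤1 = ≤ᴿ-trans (value x ⊓ᴿ value y) (value x) 1ᴿ (⊓ᴿ≤ˡ (value x) (value y)) (value≤1 x)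
  }

𝕀-setoid : Setoid 0ℓ 0ℓ
𝕀-setoid = record
  { Carrier       = 𝕀
  ; _≈_           = λ x y → x ≤ y × y ≤ x
  ; isEquivalence = record
    { refl  = λ {x} → ≤-refl x , ≤-refl x
    ; sym   = λ (x≤y , y≤x) → y≤x , x≤y
    ; trans = λ {x} {y} {z} (x≤y , y≤x) (y≤z , z≤y) →
                ≤-trans x y z x≤y y≤z , ≤-trans z y x z≤y y≤x
    }
  }

open Setoid 𝕀-setoid public using () renaming (_≈_ to _≈𝕀_)

-- The constructive form of "q is the least upper bound of s".  Classically the
-- two agree: x < q says that x is not an upper bound, so some s j exceeds it.
IsSupremum : {J : Set ι} → (J → 𝕀) → 𝕀 → Set ι
IsSupremum s q = (∀ j → s j ≤ q) × (∀ x → x < q → ∃ λ j → x < s j)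

-- The converse direction of that comparison, valid constructively.
IsSupremum⇒least : {J : Set ι} (s : J → 𝕀) (q : 𝕀) → IsSupremum s q →
                   ∀ b → (∀ j → s j ≤ b) → ¬ (b < q)
IsSupremum⇒least s q (_ , approx) b s≤b b<q with approx b b<q
... | j , b<sj = <ᴿ-irrefl (value b)
  (<ᴿ-≤ᴿ-trans (value b) (value (s j)) (value b) b<sj (s≤b j))

-- A code for each open set of [0,1]ᵤ.  Distinct codes denote distinct sets, up
-- to _≈𝕀_: 1 lies in [0,1] and in no [0,q), and [0,q) determines q.
data Openᵤ : Set where
  [0,_⟩ : 𝕀 → Openᵤ
  [0,1] : Openᵤ

infix 4 _∈ᵤ_

_∈ᵤ_ : 𝕀 → Openᵤ → Set
x ∈ᵤ [0, q ⟩ = x < q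
x ∈ᵤ [0,1]   = ⊤

Box : (Fin n → Openᵤ) → Pred (Vector 𝕀 n) 0ℓ
Box U x = ∀ i → x i ∈ᵤ U i

_∩ᵤ_ : Openᵤ → Openᵤ → Openᵤ
[0, q ⟩ ∩ᵤ [0, r ⟩ = [0, q ⊓ r ⟩
[0, q ⟩ ∩ᵤ [0,1]   = [0, q ⟩
[0,1]   ∩ᵤ V       = V

∈-∩ᵤ⁺ : ∀ x U V → x ∈ᵤ U → x ∈ᵤ V → x ∈ᵤ U ∩ᵤ V
∈-∩ᵤ⁺ x [0, q ⟩ [0, r ⟩ x<q x<r = ⊓ᴿ-<-glb (value q) (value r) (value x) x<q x<r
∈-∩ᵤ⁺ x [0, q ⟩ [0,1]   x<q _   = x<q
∈-∩ᵤ⁺ x [0,1]   V       _   x∈V = x∈V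

∈-∩ᵤ⁻ : ∀ x U V → x ∈ᵤ U ∩ᵤ V → x ∈ᵤ U × x ∈ᵤ V
∈-∩ᵤ⁻ x [0, q ⟩ [0, r ⟩ x<q⊓r =
    <-≤-trans x (q ⊓ r) q x<q⊓r (⊓ᴿ≤ˡ (value q) (value r))
  , <-≤-trans x (q ⊓ r) r x<q⊓r (⊓ᴿ≤ʳ (value q) (value r))
∈-∩ᵤ⁻ x [0, q ⟩ [0,1]   x<q = x<q , tt
∈-∩ᵤ⁻ x [0,1]   V       x∈V = tt , x∈V

∈ᵤ-downward : ∀ x y U → x ≤ y → y ∈ᵤ U → x ∈ᵤ U
∈ᵤ-downward x y [0, q ⟩ x≤y y<q = ≤-<-trans x y q x≤y y<q
∈ᵤ-downward x y [0,1]   _   _   = tt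

-- Points form a setoid; p is the level of subsets and of index types of unions.
record TopologicalSpace c ℓ p o : Set (lsuc (c ⊔ ℓ ⊔ p ⊔ o)) where
  field
    setoid : Setoid c ℓ
  open Setoid setoid public
  field
    IsOpen      : Pred (Pred Carrier p) o
    open-resp-≐ : ∀ {P Q} → P ≐ Q → IsOpen P → IsOpen Q
    open-resp-≈ : ∀ {P} → IsOpen P → P Respects _≈_
    open-U      : IsOpen (λ _ → Lift p ⊤)
    open-∩      : ∀ {P Q} → IsOpen P → IsOpen Q → IsOpen (P ∩ Q)
    open-⋃      : ∀ {J : Set p} (P : J → Pred Carrier p) →
                  (∀ j → IsOpen (P j)) → IsOpen (⋃ J P)

  open-⋂ : ∀ {n} (P : Fin n → Pred Carrier p) →
           (∀ i → IsOpen (P i)) → IsOpen (λ x → ∀ i → P i x)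
  open-⋂ {zero}  P P-open = open-resp-≐ ((λ _ ()) , λ _ → lift tt) open-U
  open-⋂ {suc n} P P-open = open-resp-≐
    ( (λ (h , t) → λ { zero → h ; (suc i) → t i })
    , (λ x∈P → x∈P zero , x∈P ∘ suc))
    (open-∩ (P-open zero) (open-⋂ (P ∘ suc) (P-open ∘ suc)))

-- The product topology on the n-fold power of [0,1]ᵤ.
[0,1]ᵤ^ : ℕ → TopologicalSpace 0ℓ 0ℓ 0ℓ 0ℓ
[0,1]ᵤ^ n = record
  { setoid      = record { isEquivalence = Pointwise.≋-isEquivalence 𝕀-setoid n }
  ; IsOpen      = λ W → ∀ x → x ∈ W → ∃ λ U → x ∈ Box U × Box U ⊆ W
  ; open-resp-≐ = λ (P⊆Q , Q⊆P) P-open x x∈Q →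
      let U , x∈U , U⊆P = P-open x (Q⊆P x∈Q) in U , x∈U , λ y∈U → P⊆Q (U⊆P y∈U)
  ; open-resp-≈ = λ P-open {x} {y} x≈y x∈P →
      let U , x∈U , U⊆P = P-open x x∈P
      in U⊆P (λ i → ∈ᵤ-downward (y i) (x i) (U i) (proj₂ (x≈y i)) (x∈U i))
  ; open-U      = λ _ _ → (λ _ → [0,1]) , (λ _ → tt) , λ _ → lift tt
  ; open-∩      = λ P-open Q-open x (x∈P , x∈Q) →
      let U , x∈U , U⊆P = P-open x x∈P
          V , x∈V , V⊆Q = Q-open x x∈Q
      in (λ i → U i ∩ᵤ V i)
       , (λ i → ∈-∩ᵤ⁺ (x i) (U i) (V i) (x∈U i) (x∈V i))
       , λ {y} y∈ → U⊆P (λ i → proj₁ (∈-∩ᵤ⁻ (y i) (U i) (V i) (y∈ i)))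
                  , V⊆Q (λ i → proj₂ (∈-∩ᵤ⁻ (y i) (U i) (V i) (y∈ i)))
  ; open-⋃      = λ P P-open x (j , x∈Pj) →
      let U , x∈U , U⊆Pj = P-open j x x∈Pj in U , x∈U , λ y∈U → j , U⊆Pj y∈U
  }

record USC (X : TopologicalSpace c ℓ p o) : Set (c ⊔ ℓ ⊔ o) where
  open TopologicalSpace X
  field
    fun      : Carrier → 𝕀
    fun-cong : ∀ {x y} → x ≈ y → fun x ≈𝕀 fun y
    usc      : ∀ q → IsOpen (λ x → Lift p (fun x < q))

module _ {X : TopologicalSpace c ℓ p o} where
  open TopologicalSpace X
  open USC

  infix  4 _≈ᵘ_
  infixr 7 _·_

  _≈ᵘ_ : USC X → USC X → Set c
  f ≈ᵘ g = ∀ x → fun f x ≈𝕀 fun g x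

  0̲ : USC X
  0̲ = record
    { fun      = λ _ → 0𝕀
    ; fun-cong = λ _ → Setoid.refl 𝕀-setoid {0𝕀}
    ; usc      = λ q → open-resp-≐ (proj₁ , λ 0<q → 0<q , lift tt)
                         (open-⋃ {Lift p (0𝕀 < q)} (λ _ _ → Lift p ⊤) (λ _ → open-U))
    }

  _·_ : USC ([0,1]ᵤ^ n) → Vector (USC X) n → USC X
  _·_ {n} a f = record
    { fun      = λ x → fun a (λ i → fun (f i) x)
    ; fun-cong = λ x≈y → fun-cong a (λ i → fun-cong (f i) x≈y)
    ; usc      = λ q → open-resp-≐
        ( (λ (lift (U , U⊆) , x∈U) → lift (lower (U⊆ (λ i → lower (x∈U i)))))
        , (λ {x} afx<q →
             let U , x∈U , U⊆ = usc a q (λ i → fun (f i) x) (lift (lower afx<q))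
             in lift (U , λ {y} → U⊆ {y}) , λ i → lift (x∈U i)))
        (open-⋃ {Lift p (∃ λ U → Box {n} U ⊆ λ y → Lift 0ℓ (fun a y < q))}
           (λ (lift (U , _)) x → ∀ i → Lift p (fun (f i) x ∈ᵤ U i))
           (λ (lift (U , _)) → open-⋂ _ (λ i → preimage-open (f i) (U i))))
    }
    where
    preimage-open : ∀ g V → IsOpen (λ x → Lift p (fun g x ∈ᵤ V))
    preimage-open g [0, r ⟩ = usc g r
    preimage-open g [0,1]   = open-U

-- The frame of opens; ι is the level of index types of joins.
record Locale c ℓ₁ ℓ₂ ι : Set (lsuc (c ⊔ ℓ₁ ⊔ ℓ₂ ⊔ ι)) where
  field
    boundedMeetSemilattice : BoundedMeetSemilattice c ℓ₁ ℓ₂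
  open BoundedMeetSemilattice boundedMeetSemilattice public
    renaming (_≤_ to _⊑_; ⊤ to 𝟙; refl to ⊑-refl; trans to ⊑-trans)
  field
    ⋁             : {J : Set ι} → (J → Carrier) → Carrier
    ⋁-upper       : ∀ {J : Set ι} (x : J → Carrier) j → x j ⊑ ⋁ x
    ⋁-least       : ∀ {J : Set ι} (x : J → Carrier) {z} → (∀ j → x j ⊑ z) → ⋁ x ⊑ z
    ∧-distribˡ-⋁  : ∀ {J : Set ι} y (x : J → Carrier) → y ∧ ⋁ x ≈ ⋁ (λ j → y ∧ x j)

  𝟘 : Carrier
  𝟘 = ⋁ {Lift ι ⊥} (λ ())

  ⋀ : Vector Carrier n → Carrier
  ⋀ = foldr _∧_ 𝟙

  ∧-mono : ∀ {w x y z} → w ⊑ x → y ⊑ z → w ∧ y ⊑ x ∧ z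
  ∧-mono {w} {x} {y} {z} w⊑x y⊑z =
    ∧-greatest (⊑-trans (x∧y≤x w y) w⊑x) (⊑-trans (x∧y≤y w y) y⊑z)

  ⋀-mono : ∀ (x y : Vector Carrier n) → (∀ i → x i ⊑ y i) → ⋀ x ⊑ ⋀ y
  ⋀-mono {zero}  x y x⊑y = ⊑-refl
  ⋀-mono {suc n} x y x⊑y = ∧-mono (x⊑y zero) (⋀-mono (x ∘ suc) (y ∘ suc) (x⊑y ∘ suc))

  ⋀-⋁-least : ∀ {K : Fin n → Set ι} (x : Vector Carrier n) (y : ∀ i → K i → Carrier) {z} →
              (∀ i → x i ⊑ ⋁ (y i)) →
              (∀ (k : ∀ i → K i) → ⋀ (λ i → y i (k i)) ⊑ z) → ⋀ x ⊑ z
  ⋀-⋁-least {zero}  x y x⊑y ⋀y⊑z = ⋀y⊑z (λ ())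
  ⋀-⋁-least {suc n} {K} x y {z} x⊑y ⋀y⊑z =
    ⊑-trans (∧-mono (x⊑y zero) ⊑-refl)
      (⊑-trans (swap _ _) (⊑-trans (reflexive (∧-distribˡ-⋁ _ _))
        (⋁-least _ λ k₀ → ⊑-trans (swap _ _)
          (⊑-trans (∧-mono ⊑-refl (head-fixed k₀)) (fold k₀)))))
    where
    swap : ∀ u v → u ∧ v ⊑ v ∧ u
    swap u v = ∧-greatest (x∧y≤y u v) (x∧y≤x u v)

    tails : K zero → Set ι
    tails _ = ∀ i → K (suc i)

    tailMeets : ∀ k₀ → tails k₀ → Carrier
    tailMeets k₀ k = ⋀ (λ i → y (suc i) (k i))

    head-fixed : ∀ k₀ → ⋀ (x ∘ suc) ⊑ ⋁ (tailMeets k₀)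
    head-fixed k₀ = ⋀-⋁-least (x ∘ suc) (λ i → y (suc i)) (x⊑y ∘ suc)
                      (⋁-upper (tailMeets k₀))

    cons : K zero → (∀ i → K (suc i)) → ∀ i → K i
    cons k₀ k zero    = k₀
    cons k₀ k (suc i) = k i

    fold : ∀ k₀ → y zero k₀ ∧ ⋁ (tailMeets k₀) ⊑ z
    fold k₀ = ⊑-trans (reflexive (∧-distribˡ-⋁ _ _))
                (⋁-least _ λ k → ⋀y⊑z (cons k₀ k))

record USCᴸ (L : Locale c ℓ₁ ℓ₂ ι) : Set (c ⊔ ℓ₁ ⊔ lsuc ι) where
  open Locale L
  field
    fun         : 𝕀 → Carrier
    preserves-⋁ : ∀ {J : Set ι} (s : J → 𝕀) q → IsSupremum s q → fun q ≈ ⋁ (fun ∘ s)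

module _ {L : Locale c ℓ₁ ℓ₂ ι} where
  open Locale L
  open USCᴸ

  infix  4 _≈ᴸ_
  infixr 7 _·ᴸ_

  _≈ᴸ_ : USCᴸ L → USCᴸ L → Set ℓ₁
  f ≈ᴸ g = ∀ q → fun f q ≈ fun g q

  -- A join over the proofs of 0 < q, as 0 < q is not decidable; see
  -- 0̲ᴸ-positive and 0̲ᴸ-zero for its values.
  0̲ᴸ : USCᴸ L
  0̲ᴸ = record
    { fun         = λ q → ⋁ {Lift ι (0𝕀 < q)} (λ _ → 𝟙)
    ; preserves-⋁ = λ s q (s≤q , approx) → antisym
        (⋁-least _ λ (lift 0<q) →
          let j , 0<sj = approx 0𝕀 0<q
          in ⊑-trans (⋁-upper _ (lift 0<sj)) (⋁-upper _ j))
        (⋁-least _ λ j → ⋁-least _ λ (lift 0<sj) →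
          ⋁-upper _ (lift (<-≤-trans 0𝕀 (s j) q 0<sj (s≤q j))))
    }

  0̲ᴸ-positive : ∀ q → 0𝕀 < q → fun 0̲ᴸ q ≈ 𝟙
  0̲ᴸ-positive q 0<q = antisym (maximum _) (⋁-upper _ (lift 0<q))

  0̲ᴸ-zero : fun 0̲ᴸ 0𝕀 ≈ 𝟘
  0̲ᴸ-zero = antisym (⋁-least _ λ (lift 0<0) → ⊥-elim (x≮0 0𝕀 0<0)) (⋁-least _ λ ())

  G : USCᴸ L → Openᵤ → Carrier
  G f [0, q ⟩ = fun f q
  G f [0,1]   = 𝟙

  fun-mono : ∀ (f : USCᴸ L) q r → q ≤ r → fun f q ⊑ fun f r
  fun-mono f q r q≤r = ⊑-trans (⋁-upper (fun f ∘ pair) (lift true))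
    (reflexive (Eq.sym (preserves-⋁ f pair r
      ( (λ { (lift true) → q≤r ; (lift false) → ≤-refl r })
      , (λ x x<r → lift false , x<r)))))
    where
    pair : Lift ι Bool → 𝕀
    pair (lift true)  = q
    pair (lift false) = r

  -- G f U is a join of elements, each attached to a point x of U and lying below
  -- G f V for every open V containing x; for U = [0,1] the point 1 suffices.
  Below : Openᵤ → Set
  Below [0, q ⟩ = ∃ λ r → r < q
  Below [0,1]   = ⊤

  point : ∀ U → Below U → 𝕀
  point [0, q ⟩ (r , _) = r
  point [0,1]   _       = 1𝕀

  point∈ : ∀ U k → point U k ∈ᵤ U
  point∈ [0, q ⟩ (_ , r<q) = r<q
  point∈ [0,1]   _         = tt

  G-at : USCᴸ L → ∀ U → Below U → Carrier
  G-at f [0, q ⟩ (r , _) = fun f r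
  G-at f [0,1]   _       = 𝟙

  G-at-least : ∀ (f : USCᴸ L) U k V → point U k ∈ᵤ V → G-at f U k ⊑ G f V
  G-at-least f [0, q ⟩ (r , _) [0, s ⟩ r<s = fun-mono f r s (<⇒≤ r s r<s)
  G-at-least f [0,1]   _       [0, s ⟩ 1<s = ⊥-elim (1≮x s 1<s)
  G-at-least f U       k       [0,1]   _   = maximum _

  G⊑⋁G-at : ∀ (f : USCᴸ L) U → G f U ⊑ ⋁ {Lift ι (Below U)} (λ k → G-at f U (lower k))
  G⊑⋁G-at f [0, q ⟩ = reflexive (preserves-⋁ f (λ (lift (r , _)) → r) q
    ( (λ (lift (r , r<q)) → <⇒≤ r q r<q)
    , (λ x x<q → let r , x<r , r<q = <-dense x q x<q in lift (r , r<q) , x<r)))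
  G⊑⋁G-at f [0,1]   = ⋁-upper (λ _ → 𝟙) (lift tt)

  _·ᴸ_ : USC ([0,1]ᵤ^ n) → Vector (USCᴸ L) n → USCᴸ L
  _·ᴸ_ {n} a f = record
    { fun         = value-at
    ; preserves-⋁ = λ s q (s≤q , approx) → antisym
        (⋁-least _ λ (lift (U , U⊆)) → ⋀-⋁-least _ _ (λ i → G⊑⋁G-at (f i) (U i)) λ k →
          let x = λ i → point (U i) (lower (k i))
              j , ax<sj = approx (USC.fun a x) (U⊆ (λ i → point∈ (U i) (lower (k i))))
              V , x∈V , V⊆ = USC.usc a (s j) x (lift ax<sj)
          in ⊑-trans (⋀-mono _ _ (λ i → G-at-least (f i) (U i) (lower (k i)) (V i) (x∈V i)))
               (⊑-trans (⋁-upper _ (lift (V , λ {y} y∈V → lower (V⊆ {y} y∈V)))) (⋁-upper _ j)))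
        (⋁-least _ λ j → ⋁-least _ λ (lift (U , U⊆)) →
          ⋁-upper _ (lift (U , λ {y} y∈U →
            <-≤-trans (USC.fun a y) (s j) q (U⊆ y∈U) (s≤q j))))
    }
    where
    value-at : 𝕀 → Carrier
    value-at q = ⋁ {Lift ι (∃ λ U → Box {n} U ⊆ λ x → USC.fun a x < q)}
                   (λ (lift (U , _)) → ⋀ (λ i → G (f i) (U i)))

{-# OPTIONS --safe #-}
module Submission where

open import Data.Nat.Base using (ℕ; zero; suc)
open import Data.Product using (_,_; proj₁)
open import Data.Unit.Base using (⊤; tt)
open import Data.Vec.Functional using (Vector)
open import Function.Base using (_∘_)
open import Level using (Level; Lift; lift; lower)
open import Defs

-- The value of `a ·ᴸ f` at `q` depends on `a` only through the set where `a < q`. If `a` vanishes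
-- pointwise, this set is the whole cube for `0 < q`, giving `𝟙`, and empty at `q = 0`, giving `𝟘`
-- because empty boxes have meet `𝟘`.

-- Testing the hypothesis on constant maps from a point gives a = 0 pointwise.
-- Unlike [0,1]ᵤ^ n, a one-point space exists at every choice of levels.
point-space : ∀ {c ℓ p o} → TopologicalSpace c ℓ p o
point-space {c} {ℓ} {p} {o} = record
  { setoid      = record
    { Carrier       = Lift c ⊤
    ; _≈_           = λ _ _ → Lift ℓ ⊤
    ; isEquivalence = _
    }
  ; IsOpen      = λ _ → Lift o ⊤
  ; open-resp-≐ = _
  ; open-resp-≈ = λ _ _ Px → Px
  ; open-U      = _
  ; open-∩      = _
  ; open-⋃      = _
  }

const-usc : ∀ {c ℓ p o} → 𝕀 → USC (point-space {c} {ℓ} {p} {o})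
const-usc x = record
  { fun      = λ _ → x
  ; fun-cong = λ _ → ≤-refl x , ≤-refl x
  ; usc      = _
  }

module _ {c ℓ₁ ℓ₂ ι} (L : Locale c ℓ₁ ℓ₂ ι) where
  open Locale L

  ⋀-𝟙 : ∀ n {z} → z ⊑ ⋀ {n} (λ _ → 𝟙)
  ⋀-𝟙 zero    = maximum _
  ⋀-𝟙 (suc n) = ∧-greatest (maximum _) (⋀-𝟙 n)

  pointwise-0⇒·ᴸ≈0 : ∀ {n} (a : USC ([0,1]ᵤ^ n)) → (∀ x → USC.fun a x ≤ 0𝕀) →
                     ∀ (f : Vector (USCᴸ L) n) → a ·ᴸ f ≈ᴸ 0̲ᴸ
  pointwise-0⇒·ᴸ≈0 {n} a a≤0 f q = antisym
    -- Box U could be empty; expanding each G (f i) (U i) as a join over points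
    -- of U i supplies an x ∈ Box U, so that 0 ≤ a x < q.
    (⋁-least _ λ (lift (U , U⊆)) → ⋀-⋁-least _ _ (λ i → G⊑⋁G-at (f i) (U i)) λ k →
      let x = λ i → point {L = L} (U i) (lower (k i))
          ax<q = U⊆ (λ i → point∈ {L = L} (U i) (lower (k i)))
      in ⊑-trans (maximum _)
           (⋁-upper _ (lift (≤-<-trans 0𝕀 (USC.fun a x) q (0≤value (USC.fun a x)) ax<q))))
    -- Since `a ≤ 0 < q` everywhere, the box with all sides `[0,1]` is admissible, and its meet is
    -- `𝟙`.
    (⋁-least _ λ (lift 0<q) → ⊑-trans (⋀-𝟙 n)
      (⋁-upper _ (lift ((λ _ → [0,1]) , λ {x} _ →
        ≤-<-trans (USC.fun a x) 0𝕀 q (a≤0 x) 0<q))))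

theorem5p4p5 : ∀ {c ℓ p o c′ ℓ₁ ℓ₂ ι : Level} (n : ℕ) (a : USC ([0,1]ᵤ^ n)) →
    (∀ (X : TopologicalSpace c ℓ p o) (f : Vector (USC X) n) → a · f ≈ᵘ 0̲) →
    ∀ (L : Locale c′ ℓ₁ ℓ₂ ι) (f : Vector (USCᴸ L) n) → a ·ᴸ f ≈ᴸ 0̲ᴸ
theorem5p4p5 n a a·f≈0 L =
  pointwise-0⇒·ᴸ≈0 L a λ x → proj₁ (a·f≈0 point-space (const-usc ∘ x) (lift tt))
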